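{- Let $n\ge1$ and let $\mathbb{T}_n=\{(a\,b):a,b\in[n],a\ne b\}$ be the set of all transpositions in $\mathbb{S}_n$. A weighted $\mathbb{T}_n$-distance exists, and any weighted $\mathbb{T}_n$-distance $\mathsf{d}$ is uniquely determined by the values $\mathsf{d}(\tau,e)$, $\tau\in\mathbb{T}_n$, namely, for all $\pi,\sigma\in\mathbb{S}_n$, $$\mathsf{d}(\pi,\sigma)=\min_{(\tau_1,\dots,\tau_m)\in A_{\mathbb{T}_n}(\pi,\sigma)}\sum_{i=1}^m\mathsf{d}(\tau_i,e).$$
   Context: $\mathbb{S}_n$ is the symmetric group on $[n]=\{1,\dots,n\}$ with identity $e$; products are compositions, $(\pi\sigma)(i)=\pi(\sigma(i))$. Let $G\subseteq\mathbb{S}_n$ be closed under inverses (here $G=\mathbb{T}_n$). Rankings $\pi,\sigma\in\mathbb{S}_n$ are $G$-adjacent if $\pi=\sigma g$ for some $g\in G$. A $G$-transformation of $\pi$ into $\sigma$ is a finite sequence $(g_1,\dots,g_k)$, $k\ge0$, of elements of $G$ with $\sigma=\pi g_1g_2\cdots g_k$; $k$ is its length (the empty sequence is allowed when $\pi=\sigma$). $A_G(\pi,\sigma)$ is the set of all $G$-transformations of $\pi$ into $\sigma$; a minimum $G$-transformation is one of minimum length. $\omega$ is $G$-between $\pi$ and $\sigma$ if there is a minimum $G$-transformation $(g_1,\dots,g_k)$ of $\pi$ into $\sigma$ with $\omega=\pi g_1\cdots g_j$ for some $j\in[k]$. A function $\mathsf{d}:\mathbb{S}_n\times\mathbb{S}_n\to[0,\infty]$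 is a weighted $G$-distance if: 1. $\mathsf{d}$ is a pseudo-metric ($\mathsf{d}(\pi,\pi)=0$, symmetry, triangle inequality; distinct points may be at distance zero). 2. $\mathsf{d}$ is left-invariant: $\mathsf{d}(\sigma\pi,\sigma\omega)=\mathsf{d}(\pi,\omega)$ for all $\pi,\sigma,\omega\in\mathbb{S}_n$. 3. For any distinct $\pi,\sigma\in\mathbb{S}_n$ that are not $G$-adjacent, there exists an $\omega$ that is $G$-between $\pi$ and $\sigma$, distinct from both, such that $\mathsf{d}(\pi,\sigma)=\mathsf{d}(\pi,\omega)+\mathsf{d}(\omega,\sigma)$. -}

module Defs where

open import Data.Fin.Base using (Fin)
open import Data.Fin.Permutation using (Permutation′; _≈_; _∘ₚ_; id; transpose)
open import Data.List.Base using (List; foldr; length; take)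
open import Data.List.Relation.Unary.All using (All)
open import Data.Nat.Base as ℕ using (ℕ)
open import Data.Product.Base using (∃; ∃-syntax; ∃₂; _×_; _,_)
open import Data.Rational.Base as ℚ using (ℚ; 0ℚ)
import Data.Rational.Properties as ℚ
open import Function.Metric.Core using (DistanceFunction)
open import Function.Metric.Definitions
  using (Congruent; Definite; Symmetric; TriangleInequality)
open import Level using (0ℓ; _⊔_)
open import Relation.Binary.Core using (Rel)
open import Relation.Binary.PropositionalEquality.Core using (_≢_)
open import Relation.Nullary.Negation.Core using (¬_)
open import Relation.Unary using (Pred)

------------------------------------------------------------------------
-- The extended half-line [0,∞]

-- A number x ∈ [0,∞] is given by its Dedekind cut { q ∈ ℚ | x < q }.
-- These sets are exactly the rounded, upward closed sets of positive
-- rationals; the empty one is ∞. A lower half of the cut is not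
-- recorded: classically it is determined by the upper half.

record [0,∞] : Set₁ where
  field
    _<∙_     : Pred ℚ 0ℓ
    positive : ∀ {q} → _<∙_ q → 0ℚ ℚ.< q
    upward   : ∀ {p q} → p ℚ.< q → _<∙_ p → _<∙_ q
    rounded  : ∀ {q} → _<∙_ q → ∃[ p ] p ℚ.< q × _<∙_ p

open [0,∞] public using () renaming (_<∙_ to infix 4 _<∙_)

infix 4 _≤_ _≃_
infixl 6 _+_

_≤_ : Rel [0,∞] 0ℓ
x ≤ y = ∀ q → y <∙ q → x <∙ q

_≃_ : Rel [0,∞] 0ℓ
x ≃ y = x ≤ y × y ≤ x

0∞ : [0,∞]
0∞ = record
  { _<∙_     = λ q → 0ℚ ℚ.< q
  ; positive = λ 0<q → 0<q
  ; upward   = λ p<q 0<p → ℚ.<-trans 0<p p<q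
  ; rounded  = λ 0<q → let p , 0<p , p<q = ℚ.<-dense 0<q in p , p<q , 0<p
  }

_+_ : [0,∞] → [0,∞] → [0,∞]
x + y = record
  { _<∙_     = λ q → ∃₂ λ r s → x <∙ r × y <∙ s × r ℚ.+ s ℚ.≤ q
  ; positive = λ (r , s , x<r , y<s , r+s≤q) →
      ℚ.<-≤-trans (ℚ.+-mono-< (positive x x<r) (positive y y<s)) r+s≤q
  ; upward   = λ p<q (r , s , x<r , y<s , r+s≤p) →
      r , s , x<r , y<s , ℚ.≤-trans r+s≤p (ℚ.<⇒≤ p<q)
  ; rounded  = λ (r , s , x<r , y<s , r+s≤q) →
      let r′ , r′<r , x<r′ = rounded x x<r in
      r′ ℚ.+ s , ℚ.<-≤-trans (ℚ.+-monoˡ-< s r′<r) r+s≤q ,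
      r′ , s , x<r′ , y<s , ℚ.≤-refl
  }
  where open [0,∞]

-- m is the least of the values f i with P i; in particular it is attained.

IsMin : ∀ {a p} {I : Set a} → Pred I p → (I → [0,∞]) → [0,∞] → Set (a ⊔ p)
IsMin P f m = (∃[ i ] P i × m ≃ f i) × (∀ i → P i → m ≤ f i)

------------------------------------------------------------------------
-- The symmetric group

-- Equality of permutations is pointwise (_≈_).

𝕊 : ℕ → Set
𝕊 n = Permutation′ n

-- (π · σ)(i) = π (σ i), whereas π ∘ₚ σ applies π first.

infixl 7 _·_

_·_ : ∀ {n} → 𝕊 n → 𝕊 n → 𝕊 n
π · σ = σ ∘ₚ π

prod : ∀ {n} → List (𝕊 n) → 𝕊 n
prod = foldr _·_ id

𝕋 : ∀ n → Pred (𝕊 n) 0ℓ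
𝕋 n τ = ∃₂ λ (a b : Fin n) → a ≢ b × τ ≈ transpose a b

------------------------------------------------------------------------
-- Transformations, betweenness and weighted distances

module _ {n : ℕ} (G : Pred (𝕊 n) 0ℓ) where

  Adjacent : Rel (𝕊 n) 0ℓ
  Adjacent π σ = ∃[ g ] G g × π ≈ σ · g

  -- A G π σ gs : the sequence gs is a G-transformation of π into σ.

  A : 𝕊 n → 𝕊 n → Pred (List (𝕊 n)) 0ℓ
  A π σ gs = All G gs × σ ≈ π · prod gs

  MinimumTransformation : 𝕊 n → 𝕊 n → Pred (List (𝕊 n)) 0ℓ
  MinimumTransformation π σ gs =
    A π σ gs × (∀ hs → A π σ hs → length gs ℕ.≤ length hs)

  Between : 𝕊 n → 𝕊 n → Pred (𝕊 n) 0ℓ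
  Between π σ ω = ∃₂ λ gs j →
    MinimumTransformation π σ gs ×
    1 ℕ.≤ j × j ℕ.≤ length gs × ω ≈ π · prod (take j gs)

  record IsWeightedDistance (d : DistanceFunction (𝕊 n) [0,∞]) : Set where
    field
      -- d is a function on permutations up to _≈_.
      cong          : Congruent _≈_ _≃_ d
      ≈⇒0           : Definite _≈_ _≃_ d 0∞
      sym           : Symmetric _≃_ d
      triangle      : TriangleInequality _≤_ _+_ d
      leftInvariant : ∀ π σ ω → d (σ · π) (σ · ω) ≃ d π ω
      split         : ∀ π σ → ¬ π ≈ σ → ¬ Adjacent π σ →
                      ∃[ ω ] Between π σ ω × ¬ ω ≈ π × ¬ ω ≈ σ ×
                             d π σ ≃ d π ω + d ω σ

-- The sum of d (τᵢ , e) over a sequence (τ₁ , … , τₘ).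

weight : ∀ {n} → DistanceFunction (𝕊 n) [0,∞] → List (𝕊 n) → [0,∞]
weight d = foldr (λ τ s → d τ id + s) 0∞

{-# OPTIONS --safe #-}
-- The zero function is a weighted distance as soon as minimum transformations
-- exist: a minimum transformation of length at least two passes through an
-- intermediate point. For an arbitrary weighted distance d, the triangle
-- inequality and left invariance bound d π σ by the weight of each
-- transformation of π into σ. Conversely, splitting d π σ at points between π
-- and σ shortens the transformations involved, so it ends at adjacent pairs and
-- yields a transformation whose weight is at most d π σ. A weighted distance is
-- then a minimum of weights, which depend on d (τ , e) only.
module Submission where

open import Defs
open import Algebra.Properties.Group using (//-rightDividesˡ)
import Data.Fin.Properties as Fin
open import Data.Fin.Permutation
  using (id; flip; transpose; _⟨$⟩ʳ_; _≈_; inverseʳ)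
import Data.Fin.Permutation.Components as PC
open import Data.Fin.Permutation.Transposition.List
  using (TranspositionList; eval; decompose; eval-decompose)
open import Data.List.Base using (List; []; _∷_; [_]; _++_; length; take; drop)
open import Data.List.Properties
  using (length-take; length-drop; take++drop≡id; take-all)
open import Data.List.Relation.Unary.All using (All; []; _∷_)
open import Data.List.Relation.Unary.All.Properties using (++⁺; take⁺; drop⁺)
open import Data.Nat.Base as ℕ using (ℕ; zero; suc; NonZero; s≤s; z≤n)
import Data.Nat.Properties as ℕ
open import Data.Nat.Induction using (<-rec)
open import Data.Product.Base using (∃; ∃-syntax; _×_; _,_; proj₁; proj₂; swap)
open import Data.Rational.Base as ℚ using (0ℚ)
import Data.Rational.Properties as ℚ
open import Function.Base using (_∘_)
open import Function.Metric.Core using (DistanceFunction)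
open import Level using (0ℓ)
open import Relation.Binary.Bundles using (Preorder)
import Relation.Binary.Definitions as Binary
import Relation.Binary.Reasoning.Preorder as PreorderReasoning
open import Relation.Binary.PropositionalEquality
  using (_≡_; refl; sym; trans; cong; subst)
open import Relation.Nullary using (yes; no; ¬_; contradiction; map′; ¬?; _×-dec_)
open import Relation.Unary using (Pred; Decidable)

-- Order and addition on the extended half-line.

≤-preorder : Preorder _ _ _
≤-preorder = record
  { Carrier    = [0,∞]
  ; _≈_        = _≃_
  ; _≲_        = _≤_
  ; isPreorder = record
    { isEquivalence = record
      { refl  = (λ _ p → p) , (λ _ p → p)
      ; sym   = swap
      ; trans = λ (f , f′) (g , g′) →
          (λ q p → f q (g q p)) , (λ q p → g′ q (f′ q p))
      }
    ; reflexive = proj₁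
    ; trans     = λ f g q p → f q (g q p)
    }
  }

open Preorder ≤-preorder using (module Eq)
  renaming (refl to ≤-refl)

0≤ : ∀ x → 0∞ ≤ x
0≤ x q = [0,∞].positive x

+-mono-≤ : ∀ {x x′ y y′} → x ≤ x′ → y ≤ y′ → x + y ≤ x′ + y′
+-mono-≤ x≤ y≤ q (r , s , p , p′ , r+s≤q) = r , s , x≤ r p , y≤ s p′ , r+s≤q

y≤x+y : ∀ x y → y ≤ x + y
y≤x+y x y q (r , s , x<r , y<s , r+s≤q) = [0,∞].upward y s<q y<s
  where
  s<q : s ℚ.< q
  s<q = ℚ.<-≤-trans
    (subst (ℚ._< r ℚ.+ s) (ℚ.+-identityˡ s) (ℚ.+-monoˡ-< s ([0,∞].positive x x<r)))
    r+s≤q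

x+0≤x : ∀ x → x + 0∞ ≤ x
x+0≤x x q x<q with [0,∞].rounded x x<q
-- Roundedness supplies a bound `p` of `x` strictly below `q`; the gap `q - p` is then a positive
-- rational, hence a bound of `0∞`.
... | p , p<q , x<p = p , q ℚ.- p , x<p , 0<q-p , ℚ.≤-reflexive p+[q-p]≡q
  where
  0<q-p : 0ℚ ℚ.< q ℚ.- p
  0<q-p = subst (ℚ._< q ℚ.- p) (ℚ.+-inverseʳ p) (ℚ.+-monoˡ-< (ℚ.- p) p<q)

  p+[q-p]≡q : p ℚ.+ (q ℚ.- p) ≡ q
  p+[q-p]≡q = trans (ℚ.+-comm p (q ℚ.- p)) (//-rightDividesˡ ℚ.+-0-group p q)

+-assoc-≤ : ∀ x y z → x + (y + z) ≤ (x + y) + z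
+-assoc-≤ x y z q (u , t , (r , s , x<r , y<s , r+s≤u) , z<t , u+t≤q) =
  r , s ℚ.+ t , x<r , (s , t , y<s , z<t , ℚ.≤-refl) ,
  ℚ.≤-trans (ℚ.≤-reflexive (sym (ℚ.+-assoc r s t)))
    (ℚ.≤-trans (ℚ.+-monoˡ-≤ t r+s≤u) u+t≤q)

-- Weights of sequences.

weight-mono : ∀ {n} {G : Pred (𝕊 n) 0ℓ} (d d′ : DistanceFunction (𝕊 n) [0,∞]) →
              (∀ τ → G τ → d τ id ≤ d′ τ id) →
              ∀ {gs} → All G gs → weight d gs ≤ weight d′ gs
weight-mono d d′ d≤d′ []                   = ≤-refl {0∞}
weight-mono d d′ d≤d′ {g ∷ gs} (Gg ∷ Ggs) =
  +-mono-≤ {d g id} {d′ g id} {weight d gs} {weight d′ gs}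
    (d≤d′ g Gg) (weight-mono d d′ d≤d′ Ggs)

weight-++-≤ : ∀ {n} (d : DistanceFunction (𝕊 n) [0,∞]) gs hs →
              weight d (gs ++ hs) ≤ weight d gs + weight d hs
weight-++-≤ d []       hs = y≤x+y 0∞ (weight d hs)
weight-++-≤ d (g ∷ gs) hs = begin
  d g id + weight d (gs ++ hs)          ≲⟨ +-mono-≤ {d g id} {d g id} {weight d (gs ++ hs)}
                                             {weight d gs + weight d hs}
                                             (≤-refl {d g id}) (weight-++-≤ d gs hs) ⟩
  d g id + (weight d gs + weight d hs)  ≲⟨ +-assoc-≤ (d g id) (weight d gs) (weight d hs) ⟩
  (d g id + weight d gs) + weight d hs  ∎
  where open PreorderReasoning ≤-preorder

-- Concatenating and cutting transformations.

_≈?_ : ∀ {n} → Binary.Decidable (_≈_ {n} {n})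
π ≈? σ = Fin.all? λ i → (π ⟨$⟩ʳ i) Fin.≟ (σ ⟨$⟩ʳ i)

prod-++ : ∀ {n} (gs hs : List (𝕊 n)) → prod (gs ++ hs) ≈ prod gs · prod hs
prod-++ []       hs i = refl
prod-++ (g ∷ gs) hs i = cong (g ⟨$⟩ʳ_) (prod-++ gs hs i)

module _ {n : ℕ} {G : Pred (𝕊 n) 0ℓ} where

  A-++ : ∀ π ω σ {gs hs} → A G π ω gs → A G ω σ hs → A G π σ (gs ++ hs)
  A-++ π ω σ {gs} {hs} (Ggs , ω≈) (Ghs , σ≈) =
    ++⁺ Ggs Ghs ,
    λ i → trans (σ≈ i) (trans (ω≈ (prod hs ⟨$⟩ʳ i))
            (cong (π ⟨$⟩ʳ_) (sym (prod-++ gs hs i))))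

  A-take : ∀ π σ ω {gs} j → A G π σ gs → ω ≈ π · prod (take j gs) →
           A G π ω (take j gs)
  A-take π σ ω j (Ggs , _) ω≈ = take⁺ j Ggs , ω≈

  A-drop : ∀ π σ ω {gs} j → A G π σ gs → ω ≈ π · prod (take j gs) →
           A G ω σ (drop j gs)
  A-drop π σ ω {gs} j (Ggs , σ≈) ω≈ = drop⁺ j Ggs , λ i → trans (σ≈ i)
    (trans (cong (λ hs → π · prod hs ⟨$⟩ʳ i) (sym (take++drop≡id j gs)))
    (trans (cong (π ⟨$⟩ʳ_) (prod-++ (take j gs) (drop j gs) i))
           (sym (ω≈ (prod (drop j gs) ⟨$⟩ʳ i)))))

  -- Otherwise the prefix would be all of `gs` and end at `σ`. This makes the piece from `π` to `ω`
  -- strictly shorter than `gs`.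
  between-proper : ∀ π σ ω {gs} j → A G π σ gs → ω ≈ π · prod (take j gs) →
                   ¬ ω ≈ σ → j ℕ.< length gs
  between-proper π σ ω {gs} j (_ , σ≈) ω≈ ω≉σ = ℕ.≰⇒> λ len≤j →
    ω≉σ λ i → trans (ω≈ i)
      (trans (cong (λ hs → π · prod hs ⟨$⟩ʳ i) (take-all j gs len≤j)) (sym (σ≈ i)))

  minimum⇒between : (∀ π σ → Adjacent G π σ → Adjacent G σ π) →
    ∀ π σ {gs} → MinimumTransformation G π σ gs →
    ¬ π ≈ σ → ¬ Adjacent G π σ →
    ∃[ ω ] Between G π σ ω × ¬ ω ≈ π × ¬ ω ≈ σ
  minimum⇒between adj-sym π σ {[]} ((_ , σ≈) , _) π≉σ _ =
    contradiction (λ i → sym (σ≈ i)) π≉σ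
  minimum⇒between adj-sym π σ {g ∷ []} ((Gg ∷ [] , σ≈) , _) _ ¬adj =
    contradiction (adj-sym σ π (g , Gg , σ≈)) ¬adj
  minimum⇒between adj-sym π σ {g ∷ h ∷ gs}
    min@((Gg ∷ Ghs , σ≈) , shortest) _ ¬adj =
    π · g , (g ∷ h ∷ gs , 1 , min , s≤s z≤n , s≤s z≤n , λ _ → refl) ,
    -- If the first step did not move `π`, deleting it would leave a shorter transformation into
    -- `σ`.
    (λ πg≈π → ℕ.1+n≰n (shortest (h ∷ gs)
       (Ghs , λ i → trans (σ≈ i) (πg≈π (prod (h ∷ gs) ⟨$⟩ʳ i))))) ,
    (λ πg≈σ → ¬adj (adj-sym σ π (g , Gg , λ i → sym (πg≈σ i))))

-- Weighted distances as minimum weights.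

module _ {n : ℕ} {G : Pred (𝕊 n) 0ℓ} {d : DistanceFunction (𝕊 n) [0,∞]}
         (isWD : IsWeightedDistance G d) where

  private module D = IsWeightedDistance isWD
  open PreorderReasoning ≤-preorder

  dist-step : ∀ π g → d π (π · g) ≃ d g id
  dist-step π g = begin-equality
    d π (π · g)         ≈⟨ D.cong {π} {π · id} {π · g} {π · g} (λ _ → refl) (λ _ → refl) ⟩
    d (π · id) (π · g)  ≈⟨ D.leftInvariant id π g ⟩
    d id g              ≈⟨ D.sym id g ⟩
    d g id              ∎

  dist≤weight : ∀ π σ gs → A G π σ gs → d π σ ≤ weight d gs
  dist≤weight π σ [] (_ , σ≈) = proj₁ (D.≈⇒0 {π} {σ} λ i → sym (σ≈ i))
  dist≤weight π σ (g ∷ gs) (_ ∷ Ggs , σ≈) = begin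
    d π σ                      ≲⟨ D.triangle π (π · g) σ ⟩
    d π (π · g) + d (π · g) σ  ≲⟨ +-mono-≤ {d π (π · g)} {d g id} {d (π · g) σ} {weight d gs}
                                    (proj₁ (dist-step π g)) (dist≤weight (π · g) σ gs (Ggs , σ≈)) ⟩
    d g id + weight d gs       ∎

  module _ (adjacent? : Binary.Decidable (Adjacent G))
           (adj-sym : ∀ π σ → Adjacent G π σ → Adjacent G σ π) where

    -- Induction on `k`, a strict bound on the length of some transformation; `gs` itself only
    -- supplies this bound. In the split case the minimum transformation `ms` is no longer than
    -- `gs`, and both of its pieces at `ω` are strictly shorter than `ms`: the first since `ω`
    -- differs from `σ`, the second since `j` is at least 1.
    weight≤dist : ∀ k π σ gs → A G π σ gs → length gs ℕ.< k →
                  ∃[ hs ] A G π σ hs × weight d hs ≤ d π σ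
    weight≤dist (suc k) π σ gs π↝σ (s≤s |gs|≤k) with π ≈? σ | adjacent? π σ
    ... | yes π≈σ | _ = [] , ([] , λ i → sym (π≈σ i)) , 0≤ (d π σ)
    -- Adjacency writes `π` as `σ · g`, whereas a transformation needs `σ` as `π · g`, so it is
    -- reversed first.
    ... | no _ | yes adj with g , Gg , σ≈ ← adj-sym π σ adj =
      [ g ] , (Gg ∷ [] , σ≈) , (begin
        d g id + 0∞  ≲⟨ x+0≤x (d g id) ⟩
        d g id       ≈⟨ dist-step π g ⟨
        d π (π · g)  ≈⟨ D.cong {π} {π} {σ} {π · g} (λ _ → refl) σ≈ ⟨
        d π σ        ∎)
    ... | no π≉σ | no ¬adj
      with ω , (ms , j , (π↝σ′ , shortest) , 1≤j , j≤|ms| , ω≈) , _ , ω≉σ , d≃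
             ← D.split π σ π≉σ ¬adj =
      let
        |ms|≤k  = ℕ.≤-trans (shortest gs π↝σ) |gs|≤k
        |take|<k = ℕ.<-≤-trans
          (ℕ.≤-<-trans
            (ℕ.≤-trans (ℕ.≤-reflexive (length-take j ms)) (ℕ.m⊓n≤m j (length ms)))
            (between-proper π σ ω j π↝σ′ ω≈ ω≉σ))
          |ms|≤k
        |drop|<k = ℕ.<-≤-trans
          (ℕ.≤-<-trans (ℕ.≤-reflexive (length-drop j ms)) (ℕ.∸-monoʳ-< 1≤j j≤|ms|))
          |ms|≤k
        gs₁ , π↝ω , w₁≤ = weight≤dist k π ω (take j ms) (A-take π σ ω j π↝σ′ ω≈) |take|<k
        gs₂ , ω↝σ , w₂≤ = weight≤dist k ω σ (drop j ms) (A-drop π σ ω j π↝σ′ ω≈) |drop|<k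
      in gs₁ ++ gs₂ , A-++ π ω σ π↝ω ω↝σ , (begin
        weight d (gs₁ ++ gs₂)        ≲⟨ weight-++-≤ d gs₁ gs₂ ⟩
        weight d gs₁ + weight d gs₂  ≲⟨ +-mono-≤ {weight d gs₁} {d π ω} {weight d gs₂} {d ω σ} w₁≤ w₂≤ ⟩
        d π ω + d ω σ                ≈⟨ d≃ ⟨
        d π σ                        ∎)

    dist-isMin : ∀ π σ → ∃ (A G π σ) → IsMin (A G π σ) (weight d) (d π σ)
    dist-isMin π σ (gs , π↝σ) =
      let hs , π↝σ′ , w≤ = weight≤dist _ π σ gs π↝σ ℕ.≤-refl
      in (hs , π↝σ′ , dist≤weight π σ hs π↝σ′ , w≤) , dist≤weight π σ

-- A sequence attaining the minimum for `d′` also competes in the minimum for `d`, where its weight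
-- is no larger.
isMin-mono : ∀ {n} {G : Pred (𝕊 n) 0ℓ} (d d′ : DistanceFunction (𝕊 n) [0,∞]) π σ →
             (∀ τ → G τ → d τ id ≤ d′ τ id) →
             IsMin (A G π σ) (weight d) (d π σ) →
             IsMin (A G π σ) (weight d′) (d′ π σ) → d π σ ≤ d′ π σ
isMin-mono d d′ π σ d≤d′ (_ , lower) ((gs , π↝σ , d′≃) , _) = begin
  d π σ         ≲⟨ lower gs π↝σ ⟩
  weight d gs   ≲⟨ weight-mono d d′ d≤d′ (proj₁ π↝σ) ⟩
  weight d′ gs  ≈⟨ d′≃ ⟨
  d′ π σ        ∎
  where open PreorderReasoning ≤-preorder

-- Transpositions: adjacency, generation and minimum transformations.

module _ {n : ℕ} where

  𝕋-adjacent-sym : ∀ π σ → Adjacent (𝕋 n) π σ → Adjacent (𝕋 n) σ π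
  𝕋-adjacent-sym π σ (g , (a , b , a≢b , g≈) , π≈) =
    transpose b a , (b , a , a≢b ∘ sym , λ _ → refl) ,
    λ i → sym (trans (π≈ _)
      (cong (σ ⟨$⟩ʳ_) (trans (g≈ _) (PC.transpose-inverse a b))))

  𝕋-adjacent? : Binary.Decidable (Adjacent (𝕋 n))
  𝕋-adjacent? π σ = map′
    (λ (a , b , a≢b , π≈) → transpose a b , (a , b , a≢b , λ _ → refl) , π≈)
    (λ (g , (a , b , a≢b , g≈) , π≈) →
      a , b , a≢b , λ i → trans (π≈ i) (cong (σ ⟨$⟩ʳ_) (g≈ i)))
    (Fin.any? λ a → Fin.any? λ b → ¬? (a Fin.≟ b) ×-dec (π ≈? (σ · transpose a b)))

  -- `eval` applies the head of the list first, so the head is the rightmost factor and is appended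
  -- at the end. A pair with equal entries is the identity, which is not in `𝕋 n`, and is dropped.
  𝕋-generates-eval : ∀ π (xs : TranspositionList n) → ∃ (A (𝕋 n) π (π · eval xs))
  𝕋-generates-eval π [] = [] , [] , λ _ → refl
  𝕋-generates-eval π ((a , b) ∷ xs) with 𝕋-generates-eval π xs | a Fin.≟ b
  ... | gs , Ggs , eq | yes refl = gs , Ggs ,
    λ i → trans (cong (π · eval xs ⟨$⟩ʳ_) (transpose-diag i)) (eq i)
    where
    transpose-diag : ∀ i → PC.transpose a a i ≡ i
    transpose-diag i with i Fin.≟ a
    ... | yes i≡a = sym i≡a
    ... | no  i≢a with i Fin.≟ a
    ...   | yes i≡a = sym i≡a
    ...   | no _    = refl
  ... | gs , π↝ | no a≢b = gs ++ [ transpose a b ] ,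
    A-++ π (π · eval xs) (π · eval xs · transpose a b) π↝ ((a , b , a≢b , λ _ → refl) ∷ [] , λ _ → refl)

  𝕋-generates : ∀ π σ → ∃ (A (𝕋 n) π σ)
  𝕋-generates π σ =
    -- The product to be factored is the inverse of `π` times `σ`.
    let ρ = flip π · σ
        gs , Ggs , eq = 𝕋-generates-eval π (decompose ρ)
    in gs , Ggs , λ i → trans (sym (inverseʳ π))
         (trans (cong (π ⟨$⟩ʳ_) (sym (eval-decompose ρ i))) (eq i))

  HasLength : 𝕊 n → 𝕊 n → Pred ℕ 0ℓ
  HasLength π σ k = ∃[ gs ] length gs ≡ k × A (𝕋 n) π σ gs

  -- For a fixed length the search is finite: the first transposition ranges over pairs in `Fin n`,
  -- and the rest starts from the permutation it leads to.
  hasLength? : ∀ π σ → Decidable (HasLength π σ)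
  hasLength? π σ zero = map′
    (λ σ≈π → [] , refl , [] , σ≈π)
    (λ { ([] , _ , _ , σ≈) → σ≈ })
    (σ ≈? π)
  hasLength? π σ (suc k) = map′
    (λ (a , b , a≢b , gs , len , Ggs , eq) →
      transpose a b ∷ gs , cong suc len , (a , b , a≢b , λ _ → refl) ∷ Ggs , eq)
    (λ { (g ∷ gs , len , (a , b , a≢b , g≈) ∷ Ggs , eq) →
      a , b , a≢b , gs , ℕ.suc-injective len , Ggs ,
      λ i → trans (eq i) (cong (π ⟨$⟩ʳ_) (g≈ _)) })
    (Fin.any? λ a → Fin.any? λ b →
      ¬? (a Fin.≟ b) ×-dec hasLength? (π · transpose a b) σ k)

  -- Descent from an arbitrary transformation: the decidable search over smaller lengths either
  -- finds a shorter one, from which the descent continues, or certifies that the current one is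
  -- minimum.
  minimumTransformation : ∀ π σ → ∃ (MinimumTransformation (𝕋 n) π σ)
  minimumTransformation π σ =
    let gs , π↝σ = 𝕋-generates π σ in <-rec _ shorten (length gs) (gs , refl , π↝σ)
    where
    shorten : ∀ k → (∀ {m} → m ℕ.< k → HasLength π σ m → ∃ (MinimumTransformation (𝕋 n) π σ)) →
              HasLength π σ k → ∃ (MinimumTransformation (𝕋 n) π σ)
    shorten k rec (gs , refl , π↝σ) with ℕ.anyUpTo? (hasLength? π σ) k
    ... | yes (m , m<k , hasLength) = rec m<k hasLength
    ... | no  none = gs , π↝σ ,
      λ hs π↝σ′ → ℕ.≮⇒≥ λ |hs|<k → none (length hs , |hs|<k , hs , refl , π↝σ′)

  zero-isWeightedDistance : IsWeightedDistance (𝕋 n) (λ _ _ → 0∞)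
  zero-isWeightedDistance = record
    { cong          = λ _ _ → Eq.refl {0∞}
    ; ≈⇒0           = λ _ → Eq.refl {0∞}
    ; sym           = λ _ _ → Eq.refl {0∞}
    ; triangle      = λ _ _ _ → y≤x+y 0∞ 0∞
    ; leftInvariant = λ _ _ _ → Eq.refl {0∞}
    ; split         = λ π σ π≉σ ¬adj →
        let gs , min = minimumTransformation π σ
            ω , between , ω≉π , ω≉σ = minimum⇒between 𝕋-adjacent-sym π σ min π≉σ ¬adj
        in ω , between , ω≉π , ω≉σ , y≤x+y 0∞ 0∞ , x+0≤x 0∞
    }

theorem22 : (n : ℕ) → .{{_ : NonZero n}} →
    (∃ λ (d : DistanceFunction (𝕊 n) [0,∞]) → IsWeightedDistance (𝕋 n) d)
    × (∀ (d d′ : DistanceFunction (𝕊 n) [0,∞]) →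
    IsWeightedDistance (𝕋 n) d → IsWeightedDistance (𝕋 n) d′ →
    (∀ τ → 𝕋 n τ → d τ id ≃ d′ τ id) →
    ∀ π σ → d π σ ≃ d′ π σ)
    × (∀ (d : DistanceFunction (𝕊 n) [0,∞]) → IsWeightedDistance (𝕋 n) d →
    ∀ π σ → IsMin (A (𝕋 n) π σ) (weight d) (d π σ))
theorem22 n = (_ , zero-isWeightedDistance) , unique , isMin
  where
  isMin : ∀ (d : DistanceFunction (𝕊 n) [0,∞]) → IsWeightedDistance (𝕋 n) d →
          ∀ π σ → IsMin (A (𝕋 n) π σ) (weight d) (d π σ)
  isMin d isWD π σ = dist-isMin isWD 𝕋-adjacent? 𝕋-adjacent-sym π σ (𝕋-generates π σ)

  unique : ∀ (d d′ : DistanceFunction (𝕊 n) [0,∞]) →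
           IsWeightedDistance (𝕋 n) d → IsWeightedDistance (𝕋 n) d′ →
           (∀ τ → 𝕋 n τ → d τ id ≃ d′ τ id) → ∀ π σ → d π σ ≃ d′ π σ
  unique d d′ isWD isWD′ d≃d′ π σ =
    isMin-mono d d′ π σ (λ τ Tτ → proj₁ (d≃d′ τ Tτ)) (isMin d isWD π σ) (isMin d′ isWD′ π σ) ,
    isMin-mono d′ d π σ (λ τ Tτ → proj₂ (d≃d′ τ Tτ)) (isMin d′ isWD′ π σ) (isMin d isWD π σ)
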